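{- Let $\mathbb S_2$ be the equational theory over the signature $\{\neg,\wedge^\bullet,\vee^\bullet,\mathsf T,\mathsf F\}$ axiomatised by $\neg\mathsf T=\mathsf F$; $\ \neg\neg x=x$; $\ \neg(x\wedge^\bullet y)=\neg x\vee^\bullet\neg y$; $\ (x\wedge^\bullet y)\wedge^\bullet z=x\wedge^\bullet(y\wedge^\bullet z)$; $\ \mathsf T\wedge^\bullet x=x$; $\ x\vee^\bullet(\neg x\wedge^\bullet y)=x\vee^\bullet y$; $\ x\wedge^\bullet y=y\wedge^\bullet x$. Then $\mathbb S_2$ is strictly weaker than propositional logic with $\neg,\wedge^\bullet,\vee^\bullet$ (where these are read as classical negation, conjunction and disjunction): every equation derivable in $\mathbb S_2$ is valid in propositional logic, but the absorption law $x\wedge^\bullet(x\vee^\bullet y)=x$, its commutative variants, and their duals are not derivable in $\mathbb S_2$.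
   Context: Derivability is in equational logic. An equation is valid in propositional logic if it holds in the two-element Boolean algebra. The commutative variants of the absorption law are obtained from $x\wedge^\bullet(x\vee^\bullet y)=x$ by exchanging the arguments of occurrences of $\wedge^\bullet$ and/or $\vee^\bullet$; duals are obtained by exchanging $\wedge^\bullet$ with $\vee^\bullet$ (and $\mathsf T$ with $\mathsf F$). $\mathbb S_2$ is the two-valued variant (without the constant for "undefined") of Bochvar's three-valued strict logic. -}

module Defs where

open import Data.Bool.Base using (Bool; true; false; not; _∧_; _∨_)
open import Data.Nat.Base using (ℕ)
open import Level using (0ℓ)
open import Relation.Binary.PropositionalEquality.Core using (_≡_)
open import Relation.Unary using (Pred)

infix  8 ¬•_
infixr 7 _∧•_
infixr 6 _∨•_
infix  4 _≈_ _⇄_ _⇄ₑ_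

-- Terms over the signature {¬, ∧•, ∨•, T, F} in countably many variables.
data Term : Set where
  var       : ℕ → Term
  𝖳 𝖥       : Term
  ¬•_       : Term → Term
  _∧•_ _∨•_ : Term → Term → Term

record Equation : Set where
  constructor _≈_
  field
    lhs rhs : Term

x y z : Term
x = var 0
y = var 1
z = var 2

Substitution : Set
Substitution = ℕ → Term

_[_] : Term → Substitution → Term
var n    [ σ ] = σ n
𝖳        [ σ ] = 𝖳
𝖥        [ σ ] = 𝖥
(¬• s)   [ σ ] = ¬• (s [ σ ])
(s ∧• t) [ σ ] = (s [ σ ]) ∧• (t [ σ ])
(s ∨• t) [ σ ] = (s [ σ ]) ∨• (t [ σ ])

-- Equational logic (Birkhoff's rules) over a set Ax of axioms.
data Derivable (Ax : Pred Equation 0ℓ) : Pred Equation 0ℓ where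
  axiom   : ∀ {e} → Ax e → Derivable Ax e
  reflx   : ∀ {s} → Derivable Ax (s ≈ s)
  symm    : ∀ {s t} → Derivable Ax (s ≈ t) → Derivable Ax (t ≈ s)
  transit : ∀ {s t u} → Derivable Ax (s ≈ t) → Derivable Ax (t ≈ u) →
            Derivable Ax (s ≈ u)
  ¬-cong  : ∀ {s t} → Derivable Ax (s ≈ t) → Derivable Ax (¬• s ≈ ¬• t)
  ∧-cong  : ∀ {s s′ t t′} → Derivable Ax (s ≈ s′) → Derivable Ax (t ≈ t′) →
            Derivable Ax (s ∧• t ≈ s′ ∧• t′)
  ∨-cong  : ∀ {s s′ t t′} → Derivable Ax (s ≈ s′) → Derivable Ax (t ≈ t′) →
            Derivable Ax (s ∨• t ≈ s′ ∨• t′)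
  instan  : ∀ {s t} (σ : Substitution) → Derivable Ax (s ≈ t) →
            Derivable Ax (s [ σ ] ≈ t [ σ ])

data 𝕊₂ : Pred Equation 0ℓ where
  ¬𝖳       : 𝕊₂ (¬• 𝖳 ≈ 𝖥)
  ¬¬       : 𝕊₂ (¬• (¬• x) ≈ x)
  deMorgan : 𝕊₂ (¬• (x ∧• y) ≈ ¬• x ∨• ¬• y)
  ∧-assoc  : 𝕊₂ ((x ∧• y) ∧• z ≈ x ∧• (y ∧• z))
  𝖳∧       : 𝕊₂ (𝖳 ∧• x ≈ x)
  ∨¬∧      : 𝕊₂ (x ∨• (¬• x ∧• y) ≈ x ∨• y)
  ∧-comm   : 𝕊₂ (x ∧• y ≈ y ∧• x)

⟦_⟧ : Term → (ℕ → Bool) → Bool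
⟦ var n ⟧  ρ = ρ n
⟦ 𝖳 ⟧      ρ = true
⟦ 𝖥 ⟧      ρ = false
⟦ ¬• s ⟧   ρ = not (⟦ s ⟧ ρ)
⟦ s ∧• t ⟧ ρ = ⟦ s ⟧ ρ ∧ ⟦ t ⟧ ρ
⟦ s ∨• t ⟧ ρ = ⟦ s ⟧ ρ ∨ ⟦ t ⟧ ρ

Valid : Pred Equation 0ℓ
Valid (s ≈ t) = ∀ (ρ : ℕ → Bool) → ⟦ s ⟧ ρ ≡ ⟦ t ⟧ ρ

-- s ⇄ s′: s′ arises from s by exchanging the arguments of some (possibly
-- none) of the occurrences of ∧• and ∨• in s.
data _⇄_ : Term → Term → Set where
  var    : ∀ n → var n ⇄ var n
  𝖳      : 𝖳 ⇄ 𝖳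
  𝖥      : 𝖥 ⇄ 𝖥
  ¬•_    : ∀ {s s′} → s ⇄ s′ → ¬• s ⇄ ¬• s′
  ∧-keep : ∀ {s s′ t t′} → s ⇄ s′ → t ⇄ t′ → s ∧• t ⇄ s′ ∧• t′
  ∧-swap : ∀ {s s′ t t′} → s ⇄ s′ → t ⇄ t′ → s ∧• t ⇄ t′ ∧• s′
  ∨-keep : ∀ {s s′ t t′} → s ⇄ s′ → t ⇄ t′ → s ∨• t ⇄ s′ ∨• t′
  ∨-swap : ∀ {s s′ t t′} → s ⇄ s′ → t ⇄ t′ → s ∨• t ⇄ t′ ∨• s′

data _⇄ₑ_ : Equation → Equation → Set where
  both : ∀ {s s′ t t′} → s ⇄ s′ → t ⇄ t′ → (s ≈ t) ⇄ₑ (s′ ≈ t′)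

dualTerm : Term → Term
dualTerm (var n)  = var n
dualTerm 𝖳        = 𝖥
dualTerm 𝖥        = 𝖳
dualTerm (¬• s)   = ¬• dualTerm s
dualTerm (s ∧• t) = dualTerm s ∨• dualTerm t
dualTerm (s ∨• t) = dualTerm s ∧• dualTerm t

dual : Equation → Equation
dual (s ≈ t) = dualTerm s ≈ dualTerm t

absorption : Equation
absorption = x ∧• (x ∨• y) ≈ x

{-# OPTIONS --safe #-}

-- 𝕊₂ is sound for the strict three-valued algebra on Maybe Bool, with nothing
-- as the undefined value.  This algebra contains the Boolean algebra as the
-- subalgebra of the defined values, so derivable equations are valid.  At
-- x = T and y undefined, one side of each absorption law, variant or dual is
-- undefined while the other is T.
module Submission where

open import Defs
open import Data.Bool.Base using (Bool; true; false; not; _∧_; _∨_)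
open import Data.Bool.Properties using (not-involutive; ∨-comm)
  renaming (∧-assoc to Bool-∧-assoc; ∧-comm to Bool-∧-comm)
open import Data.Maybe.Base using (Maybe; just; nothing; map; zipWith)
open import Data.Maybe.Properties using (just-injective)
open import Data.Nat.Base using (ℕ; zero; suc)
open import Data.Product.Base using (_×_; _,_)
open import Function.Base using (_∘_)
open import Relation.Binary.PropositionalEquality
  using (_≡_; refl; sym; trans; cong; cong₂)
open import Relation.Nullary.Negation.Core using (¬_)
open import Relation.Unary using (_⊂_; _⊆_)

zipWith-comm : ∀ {A B : Set} {f : A → A → B} → (∀ a b → f a b ≡ f b a) →
               ∀ p q → zipWith f p q ≡ zipWith f q p
zipWith-comm comm (just a) (just b) = cong just (comm a b)
zipWith-comm comm (just a) nothing  = refl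
zipWith-comm comm nothing  (just b) = refl
zipWith-comm comm nothing  nothing  = refl

zipWith-assoc : ∀ {A : Set} {f : A → A → A} →
                (∀ a b c → f (f a b) c ≡ f a (f b c)) →
                ∀ p q r → zipWith f (zipWith f p q) r ≡ zipWith f p (zipWith f q r)
zipWith-assoc assoc (just a) (just b) (just c) = cong just (assoc a b c)
zipWith-assoc assoc (just a) (just b) nothing  = refl
zipWith-assoc assoc (just a) nothing  r        = refl
zipWith-assoc assoc nothing  q        r        = refl

Valuation : Set
Valuation = ℕ → Maybe Bool

-- `map` and `zipWith` return `nothing` as soon as one argument is `nothing`, even when the other
-- would decide the result: these are Bochvar's tables, not Kleene's.
strict : Term → Valuation → Maybe Bool
strict (var n)  ρ = ρ n
strict 𝖳        ρ = just true
strict 𝖥        ρ = just false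
strict (¬• s)   ρ = map not (strict s ρ)
strict (s ∧• t) ρ = zipWith _∧_ (strict s ρ) (strict t ρ)
strict (s ∨• t) ρ = zipWith _∨_ (strict s ρ) (strict t ρ)

StrictlyValid : Equation → Set
StrictlyValid (s ≈ t) = ∀ ρ → strict s ρ ≡ strict t ρ

strict-just : ∀ s (ρ : ℕ → Bool) → strict s (just ∘ ρ) ≡ just (⟦ s ⟧ ρ)
strict-just (var n)  ρ = refl
strict-just 𝖳        ρ = refl
strict-just 𝖥        ρ = refl
strict-just (¬• s)   ρ = cong (map not) (strict-just s ρ)
strict-just (s ∧• t) ρ = cong₂ (zipWith _∧_) (strict-just s ρ) (strict-just t ρ)
strict-just (s ∨• t) ρ = cong₂ (zipWith _∨_) (strict-just s ρ) (strict-just t ρ)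

-- Moves a substitution into the valuation, as the `instan` case of soundness requires.
strict-[] : ∀ s σ ρ → strict (s [ σ ]) ρ ≡ strict s (λ n → strict (σ n) ρ)
strict-[] (var n)  σ ρ = refl
strict-[] 𝖳        σ ρ = refl
strict-[] 𝖥        σ ρ = refl
strict-[] (¬• s)   σ ρ = cong (map not) (strict-[] s σ ρ)
strict-[] (s ∧• t) σ ρ = cong₂ (zipWith _∧_) (strict-[] s σ ρ) (strict-[] t σ ρ)
strict-[] (s ∨• t) σ ρ = cong₂ (zipWith _∨_) (strict-[] s σ ρ) (strict-[] t σ ρ)

map-not-involutive : ∀ p → map not (map not p) ≡ p
map-not-involutive (just a) = cong just (not-involutive a)
map-not-involutive nothing  = refl

strict-deMorgan : ∀ p q → map not (zipWith _∧_ p q) ≡ zipWith _∨_ (map not p) (map not q)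
strict-deMorgan (just true)  (just b) = refl
strict-deMorgan (just false) (just b) = refl
strict-deMorgan (just a)     nothing  = refl
strict-deMorgan nothing      q        = refl

strict-identityˡ : ∀ p → zipWith _∧_ (just true) p ≡ p
strict-identityˡ (just a) = refl
strict-identityˡ nothing  = refl

strict-∨¬∧ : ∀ p q → zipWith _∨_ p (zipWith _∧_ (map not p) q) ≡ zipWith _∨_ p q
strict-∨¬∧ (just true)  (just b) = refl
strict-∨¬∧ (just false) (just b) = refl
strict-∨¬∧ (just a)     nothing  = refl
strict-∨¬∧ nothing      q        = refl

-- The two sides of each axiom contain the same variables, so they are undefined together; on
-- defined values each axiom is a Boolean identity. Absorption breaks this pattern, as `y` occurs on
-- one side only.
axiom-strictlyValid : 𝕊₂ ⊆ StrictlyValid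
axiom-strictlyValid ¬𝖳       ρ = refl
axiom-strictlyValid ¬¬       ρ = map-not-involutive (ρ 0)
axiom-strictlyValid deMorgan ρ = strict-deMorgan (ρ 0) (ρ 1)
axiom-strictlyValid ∧-assoc  ρ = zipWith-assoc Bool-∧-assoc (ρ 0) (ρ 1) (ρ 2)
axiom-strictlyValid 𝖳∧       ρ = strict-identityˡ (ρ 0)
axiom-strictlyValid ∨¬∧      ρ = strict-∨¬∧ (ρ 0) (ρ 1)
axiom-strictlyValid ∧-comm   ρ = zipWith-comm Bool-∧-comm (ρ 0) (ρ 1)

derivable⇒strictlyValid : Derivable 𝕊₂ ⊆ StrictlyValid
derivable⇒strictlyValid (axiom a)     ρ = axiom-strictlyValid a ρ
derivable⇒strictlyValid reflx         ρ = refl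
derivable⇒strictlyValid (symm d)      ρ = sym (derivable⇒strictlyValid d ρ)
derivable⇒strictlyValid (transit d e) ρ =
  trans (derivable⇒strictlyValid d ρ) (derivable⇒strictlyValid e ρ)
derivable⇒strictlyValid (¬-cong d)    ρ = cong (map not) (derivable⇒strictlyValid d ρ)
derivable⇒strictlyValid (∧-cong d e)  ρ =
  cong₂ (zipWith _∧_) (derivable⇒strictlyValid d ρ) (derivable⇒strictlyValid e ρ)
derivable⇒strictlyValid (∨-cong d e)  ρ =
  cong₂ (zipWith _∨_) (derivable⇒strictlyValid d ρ) (derivable⇒strictlyValid e ρ)
-- The induction hypothesis is taken at the valuation that evaluates `σ` under `ρ`, not at `ρ`
-- itself.
derivable⇒strictlyValid (instan {s} {t} σ d) ρ =
  trans (strict-[] s σ ρ)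
    (trans (derivable⇒strictlyValid d (λ n → strict (σ n) ρ)) (sym (strict-[] t σ ρ)))

strictlyValid⇒valid : StrictlyValid ⊆ Valid
strictlyValid⇒valid {s ≈ t} v ρ =
  just-injective (trans (sym (strict-just s ρ)) (trans (v (just ∘ ρ)) (strict-just t ρ)))

-- Both strict binary operations are commutative, so exchanging arguments preserves values. Hence
-- one countermodel to absorption refutes all its variants.
strict-⇄ : ∀ {s s′} → s ⇄ s′ → ∀ ρ → strict s ρ ≡ strict s′ ρ
strict-⇄ (var n)      ρ = refl
strict-⇄ 𝖳            ρ = refl
strict-⇄ 𝖥            ρ = refl
strict-⇄ (¬• p)       ρ = cong (map not) (strict-⇄ p ρ)
strict-⇄ (∧-keep p q) ρ = cong₂ (zipWith _∧_) (strict-⇄ p ρ) (strict-⇄ q ρ)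
strict-⇄ (∧-swap {s} {t = t} p q) ρ =
  trans (zipWith-comm Bool-∧-comm (strict s ρ) (strict t ρ))
    (cong₂ (zipWith _∧_) (strict-⇄ q ρ) (strict-⇄ p ρ))
strict-⇄ (∨-keep p q) ρ = cong₂ (zipWith _∨_) (strict-⇄ p ρ) (strict-⇄ q ρ)
strict-⇄ (∨-swap {s} {t = t} p q) ρ =
  trans (zipWith-comm ∨-comm (strict s ρ) (strict t ρ))
    (cong₂ (zipWith _∨_) (strict-⇄ q ρ) (strict-⇄ p ρ))

strictlyValid-⇄ₑ : ∀ {e e′} → e ⇄ₑ e′ → StrictlyValid e′ → StrictlyValid e
strictlyValid-⇄ₑ (both p q) v ρ =
  trans (strict-⇄ p ρ) (trans (v ρ) (sym (strict-⇄ q ρ)))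

dualTerm-⇄ : ∀ {s s′} → s ⇄ s′ → dualTerm s ⇄ dualTerm s′
dualTerm-⇄ (var n)      = var n
dualTerm-⇄ 𝖳            = 𝖥
dualTerm-⇄ 𝖥            = 𝖳
dualTerm-⇄ (¬• p)       = ¬• dualTerm-⇄ p
dualTerm-⇄ (∧-keep p q) = ∨-keep (dualTerm-⇄ p) (dualTerm-⇄ q)
dualTerm-⇄ (∧-swap p q) = ∨-swap (dualTerm-⇄ p) (dualTerm-⇄ q)
dualTerm-⇄ (∨-keep p q) = ∧-keep (dualTerm-⇄ p) (dualTerm-⇄ q)
dualTerm-⇄ (∨-swap p q) = ∧-swap (dualTerm-⇄ p) (dualTerm-⇄ q)

-- Dualising turns an exchange at `∧•` into one at `∨•` and conversely, so the duals of the variants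
-- are covered by refuting `dual absorption` alone.
dual-⇄ₑ : ∀ {e e′} → e ⇄ₑ e′ → dual e ⇄ₑ dual e′
dual-⇄ₑ (both p q) = both (dualTerm-⇄ p) (dualTerm-⇄ q)

absorption-valid : Valid absorption
-- Once `x` has a value, the Boolean operations compute without inspecting `y`.
absorption-valid ρ with ρ 0
... | true  = refl
... | false = refl

onlyXDefined : Valuation
onlyXDefined zero    = just true
onlyXDefined (suc _) = nothing

absorption-¬strictlyValid : ¬ StrictlyValid absorption
-- At this valuation the equation reads `nothing ≡ just true`.
absorption-¬strictlyValid v with () ← v onlyXDefined

dual-absorption-¬strictlyValid : ¬ StrictlyValid (dual absorption)
dual-absorption-¬strictlyValid v with () ← v onlyXDefined

mainTheorem6 : (Derivable 𝕊₂ ⊂ Valid)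
    × (∀ (e : Equation) → absorption ⇄ₑ e →
    (¬ Derivable 𝕊₂ e) × (¬ Derivable 𝕊₂ (dual e)))
mainTheorem6 =
  ( (λ {e} d → strictlyValid⇒valid {e} (derivable⇒strictlyValid d))
  -- Absorption itself witnesses that the inclusion is proper.
  , λ valid⊆derivable → absorption-¬strictlyValid
      (derivable⇒strictlyValid (valid⊆derivable {absorption} absorption-valid)) )
  , λ e c →
      -- Strict validity of the variant `e` is carried back along `c` to `absorption`.
      (λ d → absorption-¬strictlyValid (strictlyValid-⇄ₑ c (derivable⇒strictlyValid d)))
    , (λ d → dual-absorption-¬strictlyValid
        (strictlyValid-⇄ₑ (dual-⇄ₑ c) (derivable⇒strictlyValid d)))
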